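{- For $D>1$, $m\ge1$, $\lambda\ge0$ and integers $K\ge1$ let $\Psi_{m,D,\lambda}(K)$ be as defined in the context. (i) For $D>1$, $m\ge2$, $\lambda>0$, the function $K\mapsto\Psi_{m,D,\lambda}(K)$ on the integers $K\ge1$ attains its minimum at a finite $K$. Write $\Psi^*_{m,D,\lambda}=\min_{K\ge1}\Psi_{m,D,\lambda}(K)$. (ii) For fixed $D>1$ and $m\ge2$, if $0<\lambda_1<\lambda_2$, then every minimizer of $\Psi_{m,D,\lambda_2}$ is no larger than every minimizer of $\Psi_{m,D,\lambda_1}$. (iii) For fixed $D>1$ and $\lambda>0$, if $2\le m_1<m_2$, then every minimizer of $\Psi_{m_2,D,\lambda}$ is no smaller than every minimizer of $\Psi_{m_1,D,\lambda}$. (iv) For $D>1$, $\lambda>0$, $\Psi^*_{m,D,\lambda}$ is strictly increasing in $m$ ($m\ge2$), and $$\Psi^*_{m,D,\lambda}<\min_{K\ge1}\bigl[1+D^{1/K}+\lambda\beta_K(D)\bigr].$$ (v) For $D>1$, $m=1$ and $\lambda>0$, the minimizer is $K_1^*=1$. For $D=1$, $K=1$ is exact for every interruption price: the residual cost $F^{\rm res}+\kappa P^{\rm res}$ of the one-round fallback equals $\operatorname{OPT}(r)$. (vi) For $D>1$, $\lambda=0$, $m\ge2$, $$\inf_{K\ge1}\Psi_{m,D,0}(K)=\frac{2m}{m+1},$$ and this infimum is not attained at any finite $K$.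
   Context: For $D>1$: $\alpha_m(c)=1+c-\frac{2c}{m+1}$; $\beta_1(D)=0$ and $\beta_K(D)=\max_{1\le q<K} qD^{ -q/K}$ over integers $q$ for $K\ge2$; $\Psi_{m,D,\lambda}(K)=\alpha_m(D^{1/K})+\lambda\beta_K(D)$. For the $D=1$ assertion: there are jobs with processing times all equal to $s_0$ on a unit-speed resumable machine, each with a reported interval $[\ell_j,u_j]$, $0<\ell_j\le u_j<\infty$. Jobs are run nonpreemptively in nondecreasing order of $u_j$ (ties by a fixed label rule) until some running job $e$ has received $u_e$ units of service and is still unfinished (trigger, at time $\tau$). At the trigger, the unfinished jobs have remaining sizes $r$ with $r_e=p_e-u_e>0$ for the triggering job and $r_j=p_j=s_0$ for the others. The one-round fallback ($K=1$) serves the unfinished jobs in the order: triggering job first, then the others in the inherited order, each until completion or until its service since $\tau$ reaches $s_0$. $F^{\rm res}$ is the sum over these jobs of completion time minus $\tau$; $P^{\rm res}$ is the number of switches away from a still unfinished job after $\tau$; $\kappa\ge0$ is the price per such interruption (with $\lambda=\kappa/s_0$); $\operatorname{OPT}(r)$ is the minimum total completion time for sizes $r$, $\operatorname{OPT}(r)=\sum_{i=1}^m(m-i+1)r_{(i)}$ with $r_{(1)}\le\dots\le r_{(m)}$. -}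

module Defs where

open import Algebra.Bundles using (CommutativeRing; Semiring)
open import Algebra.Structures using (IsCommutativeRing)
open import Data.Fin.Base using (Fin)
open import Data.List.Base using (List; []; _∷_; applyUpTo; foldr; length; map)
open import Data.Maybe.Base using (Maybe; just; nothing)
open import Data.Nat.Base as ℕ using (ℕ; zero; suc; NonZero)
open import Data.Product using (Σ-syntax; ∃-syntax; _×_; _,_; proj₁)
open import Data.Sum.Base using (inj₁; inj₂)
open import Level using (0ℓ)
open import Relation.Binary.Bundles using (DecTotalOrder; TotalOrder)
open import Relation.Binary.Definitions using (tri<; tri≈; tri>)
open import Relation.Binary.Structures using (IsStrictTotalOrder; IsDecTotalOrder)
open import Relation.Nullary using (¬_; yes; no)
import Algebra.Definitions.RawSemiring as RawSemiringOps
import Algebra.Properties.Semiring.Exp as Exp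
import Data.List.Extrema as Extrema
import Data.List.Sort as Sort
import Relation.Binary.Construct.StrictToNonStrict as NonStrict
import Relation.Binary.Reasoning.Setoid as SetoidReasoning

-- The axioms of the classical real numbers.  A Dedekind-complete ordered field
-- is unique up to isomorphism, so a statement about every
-- CompleteOrderedField is a statement about ℝ.  The value of _⁻¹ at zero is
-- unspecified.  Suprema are given in approximating form (every y < s is
-- exceeded by an element of P), which classically is the least-upper-bound
-- property.
record CompleteOrderedField : Set₁ where
  infix  4 _≈_ _<_
  infixl 6 _+_ _-_
  infixl 7 _*_ _/_
  infix  8 -_ _⁻¹
  field
    Carrier            : Set
    _≈_ _<_            : Carrier → Carrier → Set
    _+_ _*_            : Carrier → Carrier → Carrier
    -_ _⁻¹             : Carrier → Carrier
    0# 1#              : Carrier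
    isCommutativeRing  : IsCommutativeRing _≈_ _+_ _*_ -_ 0# 1#
    isStrictTotalOrder : IsStrictTotalOrder _≈_ _<_
    0<1                : 0# < 1#
    ⁻¹-inverseʳ        : ∀ x → ¬ (x ≈ 0#) → (x * x ⁻¹) ≈ 1#
    +-monoʳ-<          : ∀ z {x y} → x < y → (z + x) < (z + y)
    *-pos              : ∀ {x y} → 0# < x → 0# < y → 0# < (x * y)

  open NonStrict _≈_ _<_ public using (_≤_)

  IsUpperBound : (Carrier → Set) → Carrier → Set
  IsUpperBound P b = ∀ x → P x → x ≤ b

  IsSupremum : (Carrier → Set) → Carrier → Set
  IsSupremum P s = IsUpperBound P s × (∀ y → y < s → ∃[ x ] P x × y < x)

  field
    complete : (P : Carrier → Set) → ∃[ x ] P x → ∃[ b ] IsUpperBound P b →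
               ∃[ s ] IsSupremum P s

  commutativeRing : CommutativeRing 0ℓ 0ℓ
  commutativeRing = record { isCommutativeRing = isCommutativeRing }

  semiring : Semiring 0ℓ 0ℓ
  semiring = CommutativeRing.semiring commutativeRing

  isDecTotalOrder : IsDecTotalOrder _≈_ _≤_
  isDecTotalOrder = NonStrict.isDecTotalOrder _≈_ _<_ isStrictTotalOrder

  decTotalOrder : DecTotalOrder 0ℓ 0ℓ 0ℓ
  decTotalOrder = record { isDecTotalOrder = isDecTotalOrder }

  totalOrder : TotalOrder 0ℓ 0ℓ 0ℓ
  totalOrder = DecTotalOrder.totalOrder decTotalOrder

  open IsDecTotalOrder isDecTotalOrder public using (_≤?_)
  open RawSemiringOps (Semiring.rawSemiring semiring) public using (_^_)
  open RawSemiringOps (Semiring.rawSemiring semiring) using () renaming (_×_ to _·_)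

  _-_ : Carrier → Carrier → Carrier
  x - y = x + (- y)

  _/_ : Carrier → Carrier → Carrier
  x / y = x * y ⁻¹

  fromℕ : ℕ → Carrier
  fromℕ n = n · 1#

module Optimum (ℝ : CompleteOrderedField) where
  open CompleteOrderedField ℝ

  -- Real-valued functions of an integer K ≥ 1.
  PosFun : Set
  PosFun = (K : ℕ) .{{_ : NonZero K}} → Carrier

  IsMinimizer : PosFun → (K : ℕ) .{{_ : NonZero K}} → Set
  IsMinimizer f K = ∀ J .{{_ : NonZero J}} → f K ≤ f J

  IsMinimum : PosFun → Carrier → Set
  IsMinimum f v = Σ[ K ∈ ℕ ] Σ[ K≥1 ∈ NonZero K ]
    IsMinimizer f K {{K≥1}} × f K {{K≥1}} ≈ v

  IsInfimum : PosFun → Carrier → Set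
  IsInfimum f v =
    (∀ K .{{_ : NonZero K}} → v ≤ f K) ×
    (∀ y → v < y → Σ[ K ∈ ℕ ] Σ[ K≥1 ∈ NonZero K ] f K {{K≥1}} < y)

module Objective (ℝ : CompleteOrderedField) where
  open CompleteOrderedField ℝ
  open Optimum ℝ
  open CommutativeRing commutativeRing
    using (setoid; refl; sym; trans; *-identityˡ; *-identityʳ; distribˡ;
           +-identityˡ; +-identityʳ; +-congʳ; +-congˡ; *-congˡ;
           +-assoc; +-comm; -‿inverseʳ)
  open IsStrictTotalOrder isStrictTotalOrder
    using (compare; <-respʳ-≈; <-respˡ-≈) renaming (trans to <-trans)
  open TotalOrder totalOrder using () renaming (trans to ≤-trans; refl to ≤-refl)
  open Extrema totalOrder using (max)

  *-monoʳ-< : ∀ {x y z} → 0# < z → x < y → z * x < z * y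
  *-monoʳ-< {x} {y} {z} 0<z x<y =
    <-respˡ-≈ (+-identityʳ _) (<-respʳ-≈ eq (+-monoʳ-< (z * x) (*-pos 0<z 0<y-x)))
    where
    open SetoidReasoning setoid
    0<y-x : 0# < y - x
    0<y-x = <-respʳ-≈ (+-comm _ _)
      (<-respˡ-≈ (trans (+-comm _ _) (-‿inverseʳ x)) (+-monoʳ-< (- x) x<y))
    x+[y-x]≈y : x + (y - x) ≈ y
    x+[y-x]≈y = begin
      x + (y + (- x))   ≈⟨ +-congˡ (+-comm y (- x)) ⟩
      x + ((- x) + y)   ≈⟨ +-assoc x (- x) y ⟨
      (x + (- x)) + y   ≈⟨ +-congʳ (-‿inverseʳ x) ⟩
      0# + y            ≈⟨ +-identityˡ y ⟩
      y                 ∎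
    eq : z * x + z * (y - x) ≈ z * y
    eq = trans (sym (distribˡ z x (y - x))) (*-congˡ x+[y-x]≈y)

  1≤x^n : ∀ {x} → 0# < x → 1# < x → ∀ n → 1# ≤ x ^ n
  x≤x^suc : ∀ {x} → 0# < x → 1# < x → ∀ n → x ≤ x ^ suc n
  1≤x^n _ _ zero = ≤-refl
  1≤x^n 0<x 1<x (suc n) = ≤-trans (inj₁ 1<x) (x≤x^suc 0<x 1<x n)
  x≤x^suc {x} 0<x 1<x n with 1≤x^n 0<x 1<x n
  ... | inj₁ 1<x^n = inj₁ (<-respˡ-≈ (*-identityʳ x) (*-monoʳ-< 0<x 1<x^n))
  ... | inj₂ 1≈x^n = inj₂ (trans (sym (*-identityʳ x)) (*-congˡ 1≈x^n))

  1^n≈1 : ∀ n → 1# ^ n ≈ 1#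
  1^n≈1 zero    = refl
  1^n≈1 (suc n) = trans (*-identityˡ _) (1^n≈1 n)

  x^K<D⇒x≤D : ∀ {x D} K .{{_ : NonZero K}} → 1# < D → 0# < x → x ^ K < D → x ≤ D
  x^K<D⇒x≤D {x} (suc n) 1<D 0<x x^K<D with compare x 1#
  ... | tri< x<1 _ _ = inj₁ (<-trans x<1 1<D)
  ... | tri≈ _ x≈1 _ = inj₁ (<-respˡ-≈ (sym x≈1) 1<D)
  ... | tri> _ _ 1<x = ≤-trans (x≤x^suc 0<x 1<x n) (inj₁ x^K<D)

  module _ (D : Carrier) (1<D : 1# < D) where

    -- D^{1/K}, the positive K-th root, as sup { x > 0 | x^K < D }.
    root : PosFun
    root K = proj₁ (complete (λ x → 0# < x × x ^ K < D)
      (1# , 0<1 , <-respˡ-≈ (sym (1^n≈1 K)) 1<D)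
      (D , λ x (0<x , x^K<D) → x^K<D⇒x≤D K 1<D 0<x x^K<D))

    -- D^{-q/K}.
    root^- : ℕ → PosFun
    root^- q K = (root K ⁻¹) ^ q

    -- The seed of max is the q = 1 term; the list holds q = 2, …, K - 1.
    β : PosFun
    β (suc zero)        = 0#
    β K@(suc (suc n))   = max (term 1) (applyUpTo (λ i → term (suc (suc i))) n)
      where
      term : ℕ → Carrier
      term q = fromℕ q * root^- q K

  α : ℕ → Carrier → Carrier
  α m c = 1# + c - (fromℕ 2 * c) / fromℕ (suc m)

  Ψ : ℕ → (D : Carrier) → 1# < D → Carrier → PosFun
  Ψ m D 1<D lam K = α m (root D 1<D K) + lam * β D 1<D K

module Fallback (ℝ : CompleteOrderedField) where
  open CompleteOrderedField ℝ
  open Sort decTotalOrder using (sort)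

  ∑ : List Carrier → Carrier
  ∑ = foldr _+_ 0#

  -- On an ascending list r₍₁₎ ≤ … ≤ r₍ₘ₎, the entry r₍ᵢ₎ has weight m - i + 1,
  -- the length of the suffix that starts at it.
  weightedSum : List Carrier → Carrier
  weightedSum []       = 0#
  weightedSum (x ∷ xs) = fromℕ (length (x ∷ xs)) * x + weightedSum xs

  OPT : List Carrier → Carrier
  OPT r = weightedSum (sort r)

  -- Nonpreemptive service of the listed jobs, starting at the given time, with
  -- processing times p and reported upper ends u.  The result is nothing if all
  -- jobs complete, and otherwise (τ , e , rest): the trigger time, the
  -- triggering job, and the jobs not yet started, in the inherited order.
  runToTrigger : ∀ {n} (u p : Fin n → Carrier) → Carrier → List (Fin n) →
                 Maybe (Carrier × Fin n × List (Fin n))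
  runToTrigger u p now []       = nothing
  runToTrigger u p now (j ∷ js) with p j ≤? u j
  ... | yes _ = runToTrigger u p (now + p j) js
  ... | no  _ = just (now + u j , j , js)

  record Outcome : Set where
    constructor outcome
    field
      completionTimes : List Carrier
      interruptions   : ℕ
      unfinished      : List Carrier

  -- One round over the jobs with the given remaining sizes, starting at the
  -- given time: each job is served until it completes or has received cap.
  -- Stopping an unfinished job is an interruption only when another job
  -- follows; jobs the round leaves unfinished are reported with what remains.
  serveRound : (cap now : Carrier) → List Carrier → Outcome
  serveRound cap now []       = outcome [] 0 []
  serveRound cap now (r ∷ rs) with r ≤? cap
  ... | yes _ = let outcome C P U = serveRound cap (now + r) rs in
                outcome (now + r ∷ C) P U
  ... | no  _ = let outcome C P U = serveRound cap (now + cap) rs in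
                outcome C (switches rs ℕ.+ P) (r - cap ∷ U)
    where
    switches : List Carrier → ℕ
    switches []      = 0
    switches (_ ∷ _) = 1

  Fres : Carrier → Outcome → Carrier
  Fres τ o = ∑ (map (_- τ) (Outcome.completionTimes o))

  Pres : Outcome → ℕ
  Pres = Outcome.interruptions

{-# OPTIONS --safe #-}

-- The objective is α_m(c) + λβ = 1 + γ_m c + λβ with c = D^{1/K} and
-- γ_m = (m - 1)/(m + 1), which increases strictly from γ_1 = 0 towards 1.  In K,
-- c decreases strictly to 1, while β increases strictly and without bound, so
-- minimizers exist when λ > 0.  Minimizers are monotone in λ and in m by an
-- exchange argument: adding the two optimality conditions contradicts the
-- rearrangement inequality for the changing weight and its strictly monotone
-- factor.  For D = 1 the triggering job has less than s₀ left, so it may go first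
-- in a shortest-first order, and every job completes within the cap s₀.

module Submission where

open import Defs
open import Algebra.Bundles using (CommutativeRing)
open import Data.Fin.Base using (Fin)
open import Data.List.Base using (List; []; _∷_; allFin; applyUpTo; length; map)
open import Data.List.Relation.Binary.Permutation.Propositional using (_↭_)
open import Data.List.Relation.Binary.Pointwise using (Pointwise; []; _∷_; Pointwise-length)
open import Data.List.Relation.Unary.All as All using (All; []; _∷_)
open import Data.List.Relation.Unary.All.Properties using (applyUpTo⁺₁; applyUpTo⁻)
open import Data.List.Relation.Unary.Linked using (Linked; [-]; _∷_)
open import Data.List.Relation.Unary.Sorted.TotalOrder.Properties using (↗↭↗⇒≋)
open import Data.Maybe.Base using (just)
open import Data.Nat.Base as ℕ using (ℕ; zero; suc; NonZero; z≤n; s≤s)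
open import Data.Product using (Σ-syntax; ∃-syntax; _×_; _,_; proj₁; proj₂)
open import Data.Sum.Base using (_⊎_; inj₁; inj₂)
open import Relation.Binary.Bundles using (StrictPartialOrder)
open import Relation.Binary.Definitions using (tri<; tri≈; tri>)
open import Relation.Binary.PropositionalEquality.Core using (_≡_)
open import Relation.Binary.Structures using (IsStrictTotalOrder)
open import Relation.Nullary using (¬_; yes; no; contradiction)
import Algebra.Properties.CommutativeSemigroup as CommutativeSemigroupProperties
import Algebra.Properties.CommutativeSemiring.Exp as Exp
import Algebra.Properties.Ring as RingProperties
import Algebra.Properties.Semiring.Mult as Mult
import Algebra.Solver.Ring.NaturalCoefficients.Default as Solver
import Data.List.Extrema as Extrema
import Data.List.Relation.Unary.All.Properties as All
import Data.List.Relation.Unary.Sorted.TotalOrder as Sorted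
import Data.List.Sort as Sort
import Data.List.Sort.Base as SortBase
import Data.Nat.Properties as ℕ
import Relation.Binary.PropositionalEquality.Core as ≡
import Relation.Binary.Reasoning.StrictPartialOrder as StrictReasoning

-- Order and arithmetic in a complete ordered field.

module OrderedField (ℝ : CompleteOrderedField) where
  open CompleteOrderedField ℝ
  open CommutativeRing commutativeRing public
    using (commutativeSemiring; ring; +-commutativeSemigroup; *-commutativeSemigroup;
           refl; sym; trans; reflexive;
           +-cong; +-congˡ; +-congʳ; +-comm; +-assoc; +-identityˡ; +-identityʳ;
           *-cong; *-congˡ; *-congʳ; *-comm; *-assoc; *-identityˡ; *-identityʳ;
           zeroˡ; zeroʳ; distribˡ; distribʳ; -‿inverseʳ; -‿inverseˡ; -‿cong)
  open IsStrictTotalOrder isStrictTotalOrder public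
    using (compare; irrefl; asym; <-respˡ-≈; <-respʳ-≈; isStrictPartialOrder)
    renaming (trans to <-trans)
  open Exp commutativeSemiring public
    using (^-congˡ; ^-distrib-*)
  open Mult semiring public using (×1-homo-*)
  open RingProperties ring public using (-‿distribˡ-*; xyx⁻¹≈y)
  open CommutativeSemigroupProperties +-commutativeSemigroup public
    using () renaming (interchange to +-interchange; xy∙z≈y∙xz to [x+y]+z≈y+[x+z])
  open CommutativeSemigroupProperties *-commutativeSemigroup public
    using () renaming (x∙yz≈y∙xz to x*[y*z]≈y*[x*z])
  open Objective ℝ public using (*-monoʳ-<; 1^n≈1)
  open Solver commutativeSemiring using (solve; _:=_; _:+_; _:*_; con)

  strictPartialOrder : StrictPartialOrder _ _ _
  strictPartialOrder = record { isStrictPartialOrder = isStrictPartialOrder }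

  module ≤-Reasoning = StrictReasoning strictPartialOrder
  open ≤-Reasoning

  ≤-refl : ∀ {x} → x ≤ x
  ≤-refl = inj₂ refl

  <-≤-trans : ∀ {x y z} → x < y → y ≤ z → x < z
  <-≤-trans {x} {y} {z} x<y y≤z = begin-strict
    x <⟨ x<y ⟩
    y ≤⟨ y≤z ⟩
    z ∎

  ≤⇒≯ : ∀ {x y} → x ≤ y → ¬ (y < x)
  ≤⇒≯ (inj₁ x<y) y<x = asym x<y y<x
  ≤⇒≯ (inj₂ x≈y) y<x = irrefl (sym x≈y) y<x

  ≮⇒≥ : ∀ {x y} → ¬ (x < y) → y ≤ x
  ≮⇒≥ {x} {y} x≮y with compare x y
  ... | tri< x<y _ _ = contradiction x<y x≮y
  ... | tri≈ _ x≈y _ = inj₂ (sym x≈y)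
  ... | tri> _ _ y<x = inj₁ y<x

  ≰⇒> : ∀ {x y} → ¬ (x ≤ y) → y < x
  ≰⇒> {x} {y} x≰y with compare x y
  ... | tri< x<y _ _ = contradiction (inj₁ x<y) x≰y
  ... | tri≈ _ x≈y _ = contradiction (inj₂ x≈y) x≰y
  ... | tri> _ _ y<x = y<x

  +-monoˡ-< : ∀ z {x y} → x < y → x + z < y + z
  +-monoˡ-< z {x} {y} x<y = begin-strict
    x + z ≈⟨ +-comm x z ⟩
    z + x <⟨ +-monoʳ-< z x<y ⟩
    z + y ≈⟨ +-comm z y ⟩
    y + z ∎

  +-monoʳ-≤ : ∀ z {x y} → x ≤ y → z + x ≤ z + y
  +-monoʳ-≤ z (inj₁ x<y) = inj₁ (+-monoʳ-< z x<y)
  +-monoʳ-≤ z (inj₂ x≈y) = inj₂ (+-congˡ x≈y)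

  +-mono-≤ : ∀ {w x y z} → w ≤ x → y ≤ z → w + y ≤ x + z
  +-mono-≤ {w} {x} {y} {z} w≤x y≤z = begin
    w + y ≤⟨ +-monoʳ-≤ w y≤z ⟩
    w + z ≈⟨ +-comm w z ⟩
    z + w ≤⟨ +-monoʳ-≤ z w≤x ⟩
    z + x ≈⟨ +-comm z x ⟩
    x + z ∎

  x<x+y : ∀ x {y} → 0# < y → x < x + y
  x<x+y x {y} 0<y = begin-strict
    x      ≈⟨ +-identityʳ x ⟨
    x + 0# <⟨ +-monoʳ-< x 0<y ⟩
    x + y  ∎

  x+[y-x]≈y : ∀ x y → x + (y - x) ≈ y
  x+[y-x]≈y x y = begin-equality
    x + (y - x)   ≈⟨ +-congˡ (+-comm y (- x)) ⟩
    x + (- x + y) ≈⟨ +-assoc x (- x) y ⟨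
    x - x + y     ≈⟨ +-congʳ (-‿inverseʳ x) ⟩
    0# + y        ≈⟨ +-identityˡ y ⟩
    y             ∎

  x<y⇒0<y-x : ∀ {x y} → x < y → 0# < y - x
  x<y⇒0<y-x {x} {y} x<y = begin-strict
    0#    ≈⟨ -‿inverseʳ x ⟨
    x - x <⟨ +-monoˡ-< (- x) x<y ⟩
    y - x ∎

  -‿anti-mono-< : ∀ {x y} → x < y → - y < - x
  -‿anti-mono-< {x} {y} x<y = begin-strict
    - y             ≈⟨ +-identityʳ _ ⟨
    - y + 0#        <⟨ +-monoʳ-< (- y) (x<y⇒0<y-x x<y) ⟩
    - y + (y - x)   ≈⟨ +-assoc _ y _ ⟨
    - y + y - x     ≈⟨ +-congʳ (-‿inverseˡ y) ⟩
    0# - x          ≈⟨ +-identityˡ _ ⟩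
    - x             ∎

  x-y<x : ∀ x {y} → 0# < y → x - y < x
  x-y<x x {y} 0<y = begin-strict
    x - y       <⟨ x<x+y _ 0<y ⟩
    x - y + y   ≈⟨ +-comm _ y ⟩
    y + (x - y) ≈⟨ x+[y-x]≈y y x ⟩
    x           ∎

  0≤1 : 0# ≤ 1#
  0≤1 = inj₁ 0<1

  *-monoˡ-< : ∀ {x y z} → 0# < z → x < y → x * z < y * z
  *-monoˡ-< {x} {y} {z} 0<z x<y = begin-strict
    x * z ≈⟨ *-comm x z ⟩
    z * x <⟨ *-monoʳ-< 0<z x<y ⟩
    z * y ≈⟨ *-comm z y ⟩
    y * z ∎

  *-monoʳ-≤ : ∀ {x y z} → 0# ≤ z → x ≤ y → z * x ≤ z * y
  *-monoʳ-≤ {x} {y} {z} (inj₂ 0≈z) _  = inj₂ (begin-equality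
    z * x  ≈⟨ *-congʳ 0≈z ⟨
    0# * x ≈⟨ zeroˡ x ⟩
    0#     ≈⟨ zeroˡ y ⟨
    0# * y ≈⟨ *-congʳ 0≈z ⟩
    z * y  ∎)
  *-monoʳ-≤ (inj₁ 0<z) (inj₁ x<y) = inj₁ (*-monoʳ-< 0<z x<y)
  *-monoʳ-≤ (inj₁ 0<z) (inj₂ x≈y) = inj₂ (*-congˡ x≈y)

  *-monoˡ-≤ : ∀ {x y z} → 0# ≤ z → x ≤ y → x * z ≤ y * z
  *-monoˡ-≤ {x} {y} {z} 0≤z x≤y = begin
    x * z ≈⟨ *-comm x z ⟩
    z * x ≤⟨ *-monoʳ-≤ 0≤z x≤y ⟩
    z * y ≈⟨ *-comm z y ⟩
    y * z ∎

  -- The gap between the two sides is (s₂ - s₁)(x₂ - x₁).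
  rearrangement : ∀ {s₁ s₂ x₁ x₂} → s₁ < s₂ → x₁ < x₂ →
                  s₁ * x₂ + s₂ * x₁ < s₁ * x₁ + s₂ * x₂
  rearrangement {s₁} {s₂} {x₁} {x₂} s₁<s₂ x₁<x₂ = begin-strict
    s₁ * x₂ + s₂ * x₁
      ≈⟨ +-cong (*-congˡ x₂≈) (*-congʳ s₂≈) ⟨
    s₁ * (x₁ + e) + (s₁ + d) * x₁
      <⟨ x<x+y _ (*-pos (x<y⇒0<y-x s₁<s₂) (x<y⇒0<y-x x₁<x₂)) ⟩
    s₁ * (x₁ + e) + (s₁ + d) * x₁ + d * e
      ≈⟨ solve 4 (λ s x d e → s :* (x :+ e) :+ (s :+ d) :* x :+ d :* e :=
                              s :* x :+ (s :+ d) :* (x :+ e))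
                 refl s₁ x₁ d e ⟩
    s₁ * x₁ + (s₁ + d) * (x₁ + e)
      ≈⟨ +-congˡ (*-cong s₂≈ x₂≈) ⟩
    s₁ * x₁ + s₂ * x₂ ∎
    where
    d = s₂ - s₁
    e = x₂ - x₁
    s₂≈ = x+[y-x]≈y s₁ s₂
    x₂≈ = x+[y-x]≈y x₁ x₂

  -- Reciprocals and cancellation.

  x>0⇒x≉0 : ∀ {x} → 0# < x → ¬ (x ≈ 0#)
  x>0⇒x≉0 0<x x≈0 = irrefl (sym x≈0) 0<x

  *-inverseʳ : ∀ {x} → 0# < x → x * x ⁻¹ ≈ 1#
  *-inverseʳ 0<x = ⁻¹-inverseʳ _ (x>0⇒x≉0 0<x)

  *-inverseˡ : ∀ {x} → 0# < x → x ⁻¹ * x ≈ 1#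
  *-inverseˡ 0<x = trans (*-comm _ _) (*-inverseʳ 0<x)

  x*[x⁻¹*y]≈y : ∀ {x} y → 0# < x → x * (x ⁻¹ * y) ≈ y
  x*[x⁻¹*y]≈y {x} y 0<x = begin-equality
    x * (x ⁻¹ * y) ≈⟨ *-assoc x _ y ⟨
    x * x ⁻¹ * y   ≈⟨ *-congʳ (*-inverseʳ 0<x) ⟩
    1# * y         ≈⟨ *-identityˡ y ⟩
    y              ∎

  x*y⁻¹*y≈x : ∀ x {y} → 0# < y → x * y ⁻¹ * y ≈ x
  x*y⁻¹*y≈x x {y} 0<y = begin-equality
    x * y ⁻¹ * y   ≈⟨ *-assoc x _ y ⟩
    x * (y ⁻¹ * y) ≈⟨ *-congˡ (*-inverseˡ 0<y) ⟩
    x * 1#         ≈⟨ *-identityʳ x ⟩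
    x              ∎

  *-cancelˡ-< : ∀ {x y z} → 0# ≤ z → z * x < z * y → x < y
  *-cancelˡ-< 0≤z zx<zy =
    ≰⇒> λ y≤x → ≤⇒≯ (*-monoʳ-≤ 0≤z y≤x) zx<zy

  *-cancelʳ-≤ : ∀ {x y z} → 0# < z → x * z ≤ y * z → x ≤ y
  *-cancelʳ-≤ 0<z xz≤yz = ≮⇒≥ λ y<x → ≤⇒≯ xz≤yz (*-monoˡ-< 0<z y<x)

  ⁻¹-pos : ∀ {x} → 0# < x → 0# < x ⁻¹
  ⁻¹-pos {x} 0<x = *-cancelˡ-< (inj₁ 0<x) (begin-strict
    x * 0#   ≈⟨ zeroʳ x ⟩
    0#       <⟨ 0<1 ⟩
    1#       ≈⟨ *-inverseʳ 0<x ⟨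
    x * x ⁻¹ ∎)

  ⁻¹-anti-mono-< : ∀ {x y} → 0# < x → x < y → y ⁻¹ < x ⁻¹
  ⁻¹-anti-mono-< {x} {y} 0<x x<y = *-cancelˡ-< (inj₁ 0<x) (begin-strict
    x * y ⁻¹ <⟨ *-monoˡ-< (⁻¹-pos 0<y) x<y ⟩
    y * y ⁻¹ ≈⟨ *-inverseʳ 0<y ⟩
    1#       ≈⟨ *-inverseʳ 0<x ⟨
    x * x ⁻¹ ∎)
    where 0<y = <-trans 0<x x<y

  dense : ∀ {x y} → x < y → ∃[ m ] x < m × m < y
  dense {x} {y} x<y = m ,
    *-cancelˡ-< (inj₁ 0<2) (begin-strict
      (1# + 1#) * x ≈⟨ 2*≈ x ⟩
      x + x         <⟨ +-monoʳ-< x x<y ⟩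
      x + y         ≈⟨ x*[x⁻¹*y]≈y (x + y) 0<2 ⟨
      (1# + 1#) * m ∎) ,
    *-cancelˡ-< (inj₁ 0<2) (begin-strict
      (1# + 1#) * m ≈⟨ x*[x⁻¹*y]≈y (x + y) 0<2 ⟩
      x + y         <⟨ +-monoˡ-< y x<y ⟩
      y + y         ≈⟨ 2*≈ y ⟨
      (1# + 1#) * y ∎)
    where
    m = (1# + 1#) ⁻¹ * (x + y)
    0<2 : 0# < 1# + 1#
    0<2 = <-trans 0<1 (x<x+y 1# 0<1)
    2*≈ : ∀ z → (1# + 1#) * z ≈ z + z
    2*≈ z = trans (distribʳ z 1# 1#) (+-cong (*-identityˡ z) (*-identityˡ z))

  -- The last component encodes that `z` is one of `x` and `y`: strict bounds that hold for both,
  -- such as `_< 1#`, pass to `z`.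
  ∃-max : ∀ x y → ∃[ z ] (x ≤ z × y ≤ z × (∀ {P : Carrier → Set} → P x → P y → P z))
  ∃-max x y with compare x y
  ... | tri< x<y _ _ = y , inj₁ x<y , ≤-refl , λ _ Py → Py
  ... | tri≈ _ x≈y _ = y , inj₂ x≈y , ≤-refl , λ _ Py → Py
  ... | tri> _ _ y<x = x , ≤-refl , inj₁ y<x , λ Px _ → Px

  -- Powers with natural exponents.

  ^-pos : ∀ {x} n → 0# < x → 0# < x ^ n
  ^-pos zero    0<x = 0<1
  ^-pos (suc n) 0<x = *-pos 0<x (^-pos n 0<x)

  ^-monoˡ-≤ : ∀ {x y} n → 0# < x → x ≤ y → x ^ n ≤ y ^ n
  ^-monoˡ-≤ zero    0<x x≤y = ≤-refl
  ^-monoˡ-≤ {x} {y} (suc n) 0<x x≤y = begin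
    x * x ^ n ≤⟨ *-monoʳ-≤ (inj₁ 0<x) (^-monoˡ-≤ n 0<x x≤y) ⟩
    x * y ^ n ≤⟨ *-monoˡ-≤ (inj₁ (^-pos n 0<y)) x≤y ⟩
    y * y ^ n ∎
    where
    0<y : 0# < y
    0<y = begin-strict
      0# <⟨ 0<x ⟩
      x  ≤⟨ x≤y ⟩
      y  ∎

  ^-monoˡ-< : ∀ {x y} n .{{_ : NonZero n}} → 0# < x → x < y → x ^ n < y ^ n
  ^-monoˡ-< {x} {y} (suc n) 0<x x<y = begin-strict
    x * x ^ n ≤⟨ *-monoʳ-≤ (inj₁ 0<x) (^-monoˡ-≤ n 0<x (inj₁ x<y)) ⟩
    x * y ^ n <⟨ *-monoˡ-< (^-pos n (<-trans 0<x x<y)) x<y ⟩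
    y * y ^ n ∎

  1≤x⇒1≤x^n : ∀ {x} n → 1# ≤ x → 1# ≤ x ^ n
  1≤x⇒1≤x^n {x} n 1≤x = begin
    1#     ≈⟨ 1^n≈1 n ⟨
    1# ^ n ≤⟨ ^-monoˡ-≤ n 0<1 1≤x ⟩
    x ^ n  ∎

  ^-monoʳ-≤ : ∀ {x m n} → 1# < x → m ℕ.≤ n → x ^ m ≤ x ^ n
  ^-monoʳ-≤ {n = n} 1<x z≤n = 1≤x⇒1≤x^n n (inj₁ 1<x)
  ^-monoʳ-≤ 1<x (s≤s m≤n) = *-monoʳ-≤ (inj₁ (<-trans 0<1 1<x)) (^-monoʳ-≤ 1<x m≤n)

  ^-monoʳ-< : ∀ {x m n} → 1# < x → m ℕ.< n → x ^ m < x ^ n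
  ^-monoʳ-< {x} {m} {n} 1<x m<n = begin-strict
    x ^ m      ≈⟨ *-identityˡ _ ⟨
    1# * x ^ m <⟨ *-monoˡ-< (^-pos m (<-trans 0<1 1<x)) 1<x ⟩
    x * x ^ m  ≤⟨ ^-monoʳ-≤ 1<x m<n ⟩
    x ^ n      ∎

  ⁻¹-^-inverse : ∀ {x} n → 0# < x → (x ⁻¹) ^ n * x ^ n ≈ 1#
  ⁻¹-^-inverse {x} n 0<x = begin-equality
    (x ⁻¹) ^ n * x ^ n ≈⟨ ^-distrib-* (x ⁻¹) x n ⟨
    (x ⁻¹ * x) ^ n   ≈⟨ ^-congˡ n (*-inverseˡ 0<x) ⟩
    1# ^ n           ≈⟨ 1^n≈1 n ⟩
    1#               ∎

  -- Natural numbers in the field, the Archimedean property and Bernoulli's inequality.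

  fromℕ-nonNeg : ∀ n → 0# ≤ fromℕ n
  fromℕ-pos : ∀ n .{{_ : NonZero n}} → 0# < fromℕ n
  fromℕ-nonNeg zero    = ≤-refl
  fromℕ-nonNeg (suc n) = inj₁ (fromℕ-pos (suc n))
  fromℕ-pos (suc n) = begin-strict
    0#           <⟨ 0<1 ⟩
    1#           ≈⟨ +-identityʳ 1# ⟨
    1# + 0#      ≤⟨ +-monoʳ-≤ 1# (fromℕ-nonNeg n) ⟩
    1# + fromℕ n ∎

  fromℕ-mono-≤ : ∀ {m n} → m ℕ.≤ n → fromℕ m ≤ fromℕ n
  fromℕ-mono-≤ {n = n} z≤n = fromℕ-nonNeg n
  fromℕ-mono-≤ (s≤s m≤n) = +-monoʳ-≤ 1# (fromℕ-mono-≤ m≤n)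

  n<fromℕ[1+n] : ∀ n → fromℕ n < fromℕ (suc n)
  n<fromℕ[1+n] n = begin-strict
    fromℕ n      <⟨ x<x+y _ 0<1 ⟩
    fromℕ n + 1# ≈⟨ +-comm _ _ ⟩
    1# + fromℕ n ∎

  fromℕ-mono-< : ∀ {m n} → m ℕ.< n → fromℕ m < fromℕ n
  fromℕ-mono-< {m} {n} m<n = begin-strict
    fromℕ m       <⟨ n<fromℕ[1+n] m ⟩
    fromℕ (suc m) ≤⟨ fromℕ-mono-≤ m<n ⟩
    fromℕ n       ∎

  -- The supremum s of the integers below b has an integer within 1 below it;
  -- the next integer exceeds s, hence b.
  archimedean : ∀ b → ∃[ n ] b < fromℕ n
  archimedean b with compare b 0#
  ... | tri< b<0 _ _ = 0 , b<0
  ... | tri≈ _ b≈0 _ = 1 , <-respˡ-≈ (sym b≈0) (fromℕ-pos 1)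
  ... | tri> _ _ 0<b with complete (λ x → ∃[ n ] x ≈ fromℕ n × x ≤ b)
                             (0# , 0 , refl , inj₁ 0<b)
                             (b , λ _ (_ , _ , x≤b) → x≤b)
  ... | s , s-upper , s-approx with s-approx (s - 1#) s-1<s
    where
    s-1<s : s - 1# < s
    s-1<s = x-y<x s 0<1
  ... | x , (n , x≈n , _) , s-1<x = suc n , ≰⇒> λ n+1≤b →
        ≤⇒≯ (s-upper _ (suc n , refl , n+1≤b)) (begin-strict
          s             ≈⟨ x+[y-x]≈y 1# s ⟨
          1# + (s - 1#) <⟨ +-monoʳ-< 1# s-1<x ⟩
          1# + x        ≈⟨ +-congˡ x≈n ⟩
          1# + fromℕ n  ∎)

  archimedean-* : ∀ {x} b → 0# < x → ∃[ n ] b < fromℕ n * x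
  archimedean-* {x} b 0<x with archimedean (b * x ⁻¹)
  ... | n , b/x<n = n , (begin-strict
    b              ≈⟨ x*y⁻¹*y≈x b 0<x ⟨
    b * x ⁻¹ * x   <⟨ *-monoˡ-< 0<x b/x<n ⟩
    fromℕ n * x    ∎)

  -- The induction step drops the nonnegative term `n x²` of the product `(1 + x)(1 + n x)`.
  bernoulli : ∀ {x} n → 0# < x → 1# + fromℕ n * x ≤ (1# + x) ^ n
  bernoulli {x} zero 0<x = inj₂ (trans (+-congˡ (zeroˡ x)) (+-identityʳ 1#))
  bernoulli {x} (suc n) 0<x = begin
    1# + (1# + fromℕ n) * x
      ≤⟨ ≤-+ (inj₁ (*-pos 0<x 0<x)) ⟩
    1# + (1# + fromℕ n) * x + fromℕ n * (x * x)
      ≈⟨ solve 2 (λ n x → con 1 :+ (con 1 :+ n) :* x :+ n :* (x :* x) :=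
                          (con 1 :+ x) :* (con 1 :+ n :* x)) refl (fromℕ n) x ⟩
    (1# + x) * (1# + fromℕ n * x)
      ≤⟨ *-monoʳ-≤ (inj₁ (<-trans 0<1 (x<x+y 1# 0<x))) (bernoulli n 0<x) ⟩
    (1# + x) * (1# + x) ^ n ∎
    where
    ≤-+ : ∀ {y z} → 0# ≤ z → y ≤ y + fromℕ n * z
    ≤-+ {y} {z} 0≤z = begin
      y               ≈⟨ +-identityʳ y ⟨
      y + 0#          ≈⟨ +-congˡ (zeroʳ _) ⟨
      y + fromℕ n * 0# ≤⟨ +-monoʳ-≤ y (*-monoʳ-≤ (fromℕ-nonNeg n) 0≤z) ⟩
      y + fromℕ n * z ∎

  -- Continuity of t ↦ t ^ n at 1, from the left.
  shrink : ∀ {a b} n → 0# < a → a < b → ∃[ t ] 0# < t × t < 1# × a ≤ t ^ n * b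
  shrink {a} {b} zero 0<a a<b with dense 0<1
  ... | t , 0<t , t<1 = t , 0<t , t<1 , inj₁ (<-respʳ-≈ (sym (*-identityˡ b)) a<b)
  shrink {a} {b} (suc n) 0<a a<b with dense a<b
  ... | m , a<m , m<b with shrink n (<-trans 0<a a<m) m<b
  -- The intermediate `m` splits the loss: `t ≥ t₁` keeps `t ^ n * b` above `m`, and `t ≥ a / m`
  -- lets one more factor take `m` down to no less than `a`.
  ... | t₁ , 0<t₁ , t₁<1 , m≤t₁^n*b with ∃-max t₁ (a * m ⁻¹)
  ... | t , t₁≤t , a/m≤t , sel = t , 0<t , t<1 , (begin
    a                ≈⟨ x*y⁻¹*y≈x a 0<m ⟨
    a * m ⁻¹ * m     ≤⟨ *-monoˡ-≤ (inj₁ 0<m) a/m≤t ⟩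
    t * m            ≤⟨ *-monoʳ-≤ (inj₁ 0<t) m≤t₁^n*b ⟩
    t * (t₁ ^ n * b) ≤⟨ *-monoʳ-≤ (inj₁ 0<t)
                          (*-monoˡ-≤ (inj₁ 0<b) (^-monoˡ-≤ n 0<t₁ t₁≤t)) ⟩
    t * (t ^ n * b)  ≈⟨ *-assoc t _ b ⟨
    t * t ^ n * b    ∎)
    where
    0<m = <-trans 0<a a<m
    0<b = <-trans 0<m m<b
    0<t : 0# < t
    0<t = begin-strict
      0# <⟨ 0<t₁ ⟩
      t₁ ≤⟨ t₁≤t ⟩
      t  ∎
    t<1 : t < 1#
    t<1 = sel {_< 1#} t₁<1 (begin-strict
      a * m ⁻¹ <⟨ *-monoˡ-< (⁻¹-pos 0<m) a<m ⟩
      m * m ⁻¹ ≈⟨ *-inverseʳ 0<m ⟩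
      1#       ∎)

-- Existence and comparison of minimizers over the positive integers.

module Minimization (ℝ : CompleteOrderedField) where
  open CompleteOrderedField ℝ
  open Optimum ℝ
  open OrderedField ℝ
  open ≤-Reasoning

  IsCoercive : PosFun → Set
  IsCoercive f = ∀ b → ∃[ N ] (∀ K .{{_ : NonZero K}} → N ℕ.≤ K → b < f K)

  -- The bound `suc n` keeps the range nonempty, with the single candidate 1 as base case.
  minimizer-up-to : ∀ (f : PosFun) n → Σ[ K ∈ ℕ ] Σ[ K≥1 ∈ NonZero K ]
    (∀ J .{{_ : NonZero J}} → J ℕ.≤ suc n → f K {{K≥1}} ≤ f J)
  minimizer-up-to f zero = 1 , _ , λ where
    (suc zero)    _        → ≤-refl
    (suc (suc _)) (s≤s ())
  minimizer-up-to f (suc n) with minimizer-up-to f n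
  ... | K , K≥1 , fK≤ with f K {{K≥1}} ≤? f (suc (suc n))
  ... | yes fK≤fn = K , K≥1 , λ J J≤ → case J (ℕ.m≤n⇒m<n∨m≡n J≤)
    where
    case : ∀ J .{{_ : NonZero J}} → J ℕ.< suc (suc n) ⊎ J ≡ suc (suc n) →
           f K {{K≥1}} ≤ f J
    case J (inj₁ J<)     = fK≤ J (ℕ.s≤s⁻¹ J<)
    case J (inj₂ ≡.refl) = fK≤fn
  ... | no fK≰fn = suc (suc n) , _ , λ J J≤ → case J (ℕ.m≤n⇒m<n∨m≡n J≤)
    where
    case : ∀ J .{{_ : NonZero J}} → J ℕ.< suc (suc n) ⊎ J ≡ suc (suc n) →
           f (suc (suc n)) ≤ f J
    case J (inj₁ J<)     = begin
      f (suc (suc n)) <⟨ ≰⇒> fK≰fn ⟩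
      f K {{K≥1}}     ≤⟨ fK≤ J (ℕ.s≤s⁻¹ J<) ⟩
      f J             ∎
    case J (inj₂ ≡.refl) = ≤-refl

  -- Past the threshold `N` every value exceeds `f 1`, so a minimizer over an initial segment that
  -- contains 1 is global.
  coercive⇒minimizer : ∀ {f} → IsCoercive f →
    Σ[ K ∈ ℕ ] Σ[ K≥1 ∈ NonZero K ] IsMinimizer f K {{K≥1}}
  coercive⇒minimizer {f} coercive with coercive (f 1)
  ... | N , f1< with minimizer-up-to f N
  ... | K , K≥1 , fK≤ = K , K≥1 , minimal
    where
    minimal : IsMinimizer f K {{K≥1}}
    minimal J with ℕ.≤-total J (suc N)
    ... | inj₁ J≤1+N = fK≤ J J≤1+N
    ... | inj₂ 1+N≤J = begin
      f K {{K≥1}} ≤⟨ fK≤ 1 (s≤s z≤n) ⟩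
      f 1         <⟨ f1< J (ℕ.<⇒≤ 1+N≤J) ⟩
      f J         ∎

  IsMinimizer-resp-≈ : ∀ {f g : PosFun} → (∀ K .{{_ : NonZero K}} → f K ≈ g K) →
    ∀ {K} .{{_ : NonZero K}} → IsMinimizer f K → IsMinimizer g K
  IsMinimizer-resp-≈ {f} {g} f≈g {K} minimal J = begin
    g K ≈⟨ f≈g K ⟨
    f K ≤⟨ minimal J ⟩
    f J ≈⟨ f≈g J ⟩
    g J ∎

  -- Comparison takes place at the minimizer of `g`. Because that minimum is attained, the pointwise
  -- strictness survives; for infima only `≤` would follow.
  IsMinimum-mono-< : ∀ {f g : PosFun} → (∀ K .{{_ : NonZero K}} → f K < g K) →
    ∀ {v w} → IsMinimum f v → IsMinimum g w → v < w
  IsMinimum-mono-< {f} {g} f<g {v} {w} (J , J≥1 , fJ≤ , fJ≈v) (K , K≥1 , _ , gK≈w) =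
    begin-strict
      v           ≈⟨ fJ≈v ⟨
      f J {{J≥1}} ≤⟨ fJ≤ K {{K≥1}} ⟩
      f K {{K≥1}} <⟨ f<g K {{K≥1}} ⟩
      g K {{K≥1}} ≈⟨ gK≈w ⟩
      w           ∎

  -- Each minimizer is tested against the other and the two inequalities are added; the `Y` terms
  -- are the same on both sides. `X` is the factor of the weight that changes and `Y` is everything
  -- else, so one lemma serves both the price and the number of jobs.
  minimizer-exchange : ∀ {s₁ s₂} (X Y : PosFun) → s₁ < s₂ →
    ∀ {K₁ K₂} .{{_ : NonZero K₁}} .{{_ : NonZero K₂}} →
    IsMinimizer (λ K → s₁ * X K + Y K) K₁ →
    IsMinimizer (λ K → s₂ * X K + Y K) K₂ →
    ¬ (X K₁ < X K₂)
  minimizer-exchange {s₁} {s₂} X Y s₁<s₂ {K₁} {K₂} min₁ min₂ X₁<X₂ = ≤⇒≯ (begin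
    s₁ * X K₁ + s₂ * X K₂ + (Y K₁ + Y K₂)     ≈⟨ +-interchange _ _ _ _ ⟩
    s₁ * X K₁ + Y K₁ + (s₂ * X K₂ + Y K₂)     ≤⟨ +-mono-≤ (min₁ K₂) (min₂ K₁) ⟩
    s₁ * X K₂ + Y K₂ + (s₂ * X K₁ + Y K₁)     ≈⟨ +-interchange _ _ _ _ ⟩
    s₁ * X K₂ + s₂ * X K₁ + (Y K₂ + Y K₁)     ≈⟨ +-congˡ (+-comm _ _) ⟩
    s₁ * X K₂ + s₂ * X K₁ + (Y K₁ + Y K₂)     ∎)
    (+-monoˡ-< _ (rearrangement s₁<s₂ X₁<X₂))

-- The roots `D^{1/K}`: defining equation, strict decrease and limit 1.

module Roots (ℝ : CompleteOrderedField)
             (D : CompleteOrderedField.Carrier ℝ)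
             (1<D : CompleteOrderedField._<_ ℝ (CompleteOrderedField.1# ℝ) D) where
  open CompleteOrderedField ℝ
  open Optimum ℝ
  open Objective ℝ using (root; root^-; β)
  open OrderedField ℝ
  open Minimization ℝ
  open ≤-Reasoning
  open Extrema totalOrder using (⊥≤max; xs≤max; max<v⁺)

  0<D : 0# < D
  0<D = <-trans 0<1 1<D

  c : PosFun
  c = root D 1<D

  -- `root` is the first projection of a call of `complete`; unification with `c K` recovers that
  -- call, and its second projection is the specification.
  c-supremum : ∀ K .{{_ : NonZero K}} → IsSupremum (λ x → 0# < x × x ^ K < D) (c K)
  c-supremum K = proj₂ (complete _ _ _)

  1≤c : ∀ K .{{_ : NonZero K}} → 1# ≤ c K
  1≤c K = proj₁ (c-supremum K) 1# (0<1 , <-respˡ-≈ (sym (1^n≈1 K)) 1<D)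

  c-pos : ∀ K .{{_ : NonZero K}} → 0# < c K
  c-pos K = begin-strict
    0#  <⟨ 0<1 ⟩
    1#  ≤⟨ 1≤c K ⟩
    c K ∎

  c^K≥D : ∀ K .{{_ : NonZero K}} → D ≤ c K ^ K
  c^K≥D K = ≮⇒≥ c^K≮D
    where
    c^K≮D : ¬ (c K ^ K < D)
    c^K≮D c^K<D with dense c^K<D
    -- `shrink` yields only a weak inequality, so it is applied to some `m` strictly below `D`. Then
    -- `c K / t` has `K`-th power at most `m`, belongs to the set, and exceeds its supremum.
    ... | m , c^K<m , m<D with shrink K (^-pos K (c-pos K)) c^K<m
    ... | t , 0<t , t<1 , c^K≤t^K*m =
      ≤⇒≯ (proj₁ (c-supremum K) x (0<x , x^K<D)) c<x
      where
      x = c K * t ⁻¹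
      0<x = *-pos (c-pos K) (⁻¹-pos 0<t)
      x*t≈c = x*y⁻¹*y≈x (c K) 0<t
      c<x : c K < x
      c<x = begin-strict
        c K    ≈⟨ x*t≈c ⟨
        x * t  <⟨ *-monoʳ-< 0<x t<1 ⟩
        x * 1# ≈⟨ *-identityʳ x ⟩
        x      ∎
      x^K<D : x ^ K < D
      x^K<D = begin-strict
        x ^ K ≤⟨ *-cancelʳ-≤ (^-pos K 0<t) (begin
          x ^ K * t ^ K ≈⟨ ^-distrib-* x t K ⟨
          (x * t) ^ K   ≈⟨ ^-congˡ K x*t≈c ⟩
          c K ^ K       ≤⟨ c^K≤t^K*m ⟩
          t ^ K * m     ≈⟨ *-comm _ m ⟩
          m * t ^ K     ∎) ⟩
        m     <⟨ m<D ⟩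
        D     ∎

  c^K≤D : ∀ K .{{_ : NonZero K}} → c K ^ K ≤ D
  c^K≤D K = ≮⇒≥ D≮c^K
    where
    D≮c^K : ¬ (D < c K ^ K)
    D≮c^K D<c^K with shrink K 0<D D<c^K
    -- Since `t * c K` lies below the supremum, some member `x` of the set exceeds it; yet the
    -- `K`-th power of `t * c K` is already at least `D`.
    ... | t , 0<t , t<1 , D≤t^K*c^K with proj₂ (c-supremum K) (t * c K) (begin-strict
            t * c K  <⟨ *-monoˡ-< (c-pos K) t<1 ⟩
            1# * c K ≈⟨ *-identityˡ _ ⟩
            c K      ∎)
    ... | x , (_ , x^K<D) , tc<x = ≤⇒≯ (begin
            D               ≤⟨ D≤t^K*c^K ⟩
            t ^ K * c K ^ K ≈⟨ ^-distrib-* t (c K) K ⟨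
            (t * c K) ^ K   ≤⟨ ^-monoˡ-≤ K (*-pos 0<t (c-pos K)) (inj₁ tc<x) ⟩
            x ^ K           ∎) x^K<D

  -- Reduces an upper bound on a root to an inequality between powers; both the strict decrease and
  -- the limit of `c` are obtained this way.
  D<x^K⇒c<x : ∀ {x} K .{{_ : NonZero K}} → 0# < x → D < x ^ K → c K < x
  D<x^K⇒c<x {x} K 0<x D<x^K = ≰⇒> λ x≤c → ≤⇒≯ (begin
    x ^ K   ≤⟨ ^-monoˡ-≤ K 0<x x≤c ⟩
    c K ^ K ≤⟨ c^K≤D K ⟩
    D       ∎) D<x^K

  1<c : ∀ K .{{_ : NonZero K}} → 1# < c K
  1<c K = ≰⇒> λ c≤1 → ≤⇒≯ (begin
    D       ≤⟨ c^K≥D K ⟩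
    c K ^ K ≤⟨ ^-monoˡ-≤ K (c-pos K) c≤1 ⟩
    1# ^ K  ≈⟨ 1^n≈1 K ⟩
    1#      ∎) 1<D

  c-anti-mono-< : ∀ {J K} .{{_ : NonZero J}} .{{_ : NonZero K}} → J ℕ.< K → c K < c J
  c-anti-mono-< {J} {K} J<K = D<x^K⇒c<x K (c-pos J) (begin-strict
    D       ≤⟨ c^K≥D J ⟩
    c J ^ J <⟨ ^-monoʳ-< (1<c J) J<K ⟩
    c J ^ K ∎)

  -- By Bernoulli, powers of `1 + ε` grow at least linearly and so pass `D`. The exponent `suc n` is
  -- visibly nonzero.
  c→1 : ∀ {ε} → 0# < ε → ∃[ n ] c (suc n) < 1# + ε
  c→1 {ε} 0<ε with archimedean-* D 0<ε
  ... | n , D<nε = n , D<x^K⇒c<x (suc n) (<-trans 0<1 (x<x+y 1# 0<ε)) (begin-strict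
    D                      <⟨ D<nε ⟩
    fromℕ n * ε            <⟨ *-monoˡ-< 0<ε (n<fromℕ[1+n] n) ⟩
    fromℕ (suc n) * ε      <⟨ x<x+y _ 0<1 ⟩
    fromℕ (suc n) * ε + 1# ≈⟨ +-comm _ 1# ⟩
    1# + fromℕ (suc n) * ε ≤⟨ bernoulli (suc n) 0<ε ⟩
    (1# + ε) ^ suc n       ∎)

  -- Monotonicity and growth of `β`.

  βterm : ℕ → PosFun
  βterm q K = fromℕ q * root^- D 1<D q K

  βterm-pos : ∀ q K .{{_ : NonZero q}} .{{_ : NonZero K}} → 0# < βterm q K
  βterm-pos q K = *-pos (fromℕ-pos q) (^-pos q (⁻¹-pos (c-pos K)))

  βterm-mono-< : ∀ q {J K} .{{_ : NonZero q}} .{{_ : NonZero J}} .{{_ : NonZero K}} →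
                 J ℕ.< K → βterm q J < βterm q K
  βterm-mono-< q {J} {K} J<K = *-monoʳ-< (fromℕ-pos q)
    (^-monoˡ-< q (⁻¹-pos (c-pos J)) (⁻¹-anti-mono-< (c-pos K) (c-anti-mono-< J<K)))

  -- `βterm` agrees definitionally with the local `term` of `β`. The term `q = 1` is the seed of
  -- `max`, and `q = i + 2` stands at position `i` of the list.
  βterm≤β : ∀ q K .{{_ : NonZero q}} .{{_ : NonZero K}} → q ℕ.< K → βterm q K ≤ β D 1<D K
  βterm≤β (suc zero)    (suc zero)    (s≤s ())
  βterm≤β (suc zero)    (suc (suc n)) _                 =
    ⊥≤max _ (applyUpTo (λ i → βterm (suc (suc i)) (suc (suc n))) n)
  βterm≤β (suc (suc i)) (suc (suc n)) (s≤s (s≤s i<n)) =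
    applyUpTo⁻ _ n (xs≤max _ _) i<n

  -- A maximum of finitely many terms below `v` is below `v`. At `K = 1` there are no terms while
  -- `β` has the default value 0, whence the bound `2 ≤ K`.
  β<upper-bound : ∀ {v} K → 2 ℕ.≤ K → .{{_ : NonZero K}} →
    (∀ q .{{_ : NonZero q}} → q ℕ.< K → βterm q K < v) → β D 1<D K < v
  β<upper-bound (suc zero)    (s≤s ()) _
  β<upper-bound (suc (suc n)) _ term<v = ≤×≉⇒< (max<v⁺ (<⇒≤×≉ (term<v 1 (s≤s (s≤s z≤n))))
    (applyUpTo⁺₁ _ n λ i<n → <⇒≤×≉ (term<v _ (s≤s (s≤s i<n)))))
    where
    -- The strict order in `Extrema` is derived from `≤` as `≤` together with `≉`, so strict
    -- inequalities are translated both ways.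
    <⇒≤×≉ : ∀ {x y} → x < y → x ≤ y × ¬ (x ≈ y)
    <⇒≤×≉ x<y = inj₁ x<y , λ x≈y → irrefl x≈y x<y
    ≤×≉⇒< : ∀ {x y} → x ≤ y × ¬ (x ≈ y) → x < y
    ≤×≉⇒< (inj₁ x<y , _)   = x<y
    ≤×≉⇒< (inj₂ x≈y , x≉y) = contradiction x≈y x≉y

  β-pos : ∀ K .{{_ : NonZero K}} → 2 ℕ.≤ K → 0# < β D 1<D K
  β-pos K 2≤K = begin-strict
    0#        <⟨ βterm-pos 1 K ⟩
    βterm 1 K ≤⟨ βterm≤β 1 K 2≤K ⟩
    β D 1<D K ∎

  β-nonNeg : ∀ K .{{_ : NonZero K}} → 0# ≤ β D 1<D K
  β-nonNeg (suc zero)        = ≤-refl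
  β-nonNeg K@(suc (suc _)) = inj₁ (β-pos K (s≤s (s≤s z≤n)))

  -- Passing from `J` to `K` raises every term, as the root falls, and only adds values of `q`. For
  -- `J = 1` the hypothesis reads `2 ≤ K`, and the claim is positivity.
  β-mono-< : ∀ {J K} .{{_ : NonZero J}} .{{_ : NonZero K}} →
             J ℕ.< K → β D 1<D J < β D 1<D K
  β-mono-< {suc zero} {K} J<K = β-pos K J<K
  β-mono-< {J@(suc (suc _))} {K} J<K = β<upper-bound J (s≤s (s≤s z≤n)) λ q q<J →
    begin-strict
      βterm q J <⟨ βterm-mono-< q J<K ⟩
      βterm q K ≤⟨ βterm≤β q K (ℕ.<-trans q<J J<K) ⟩
      β D 1<D K ∎

  β-mono-≤ : ∀ {J K} .{{_ : NonZero J}} .{{_ : NonZero K}} →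
             J ℕ.≤ K → β D 1<D J ≤ β D 1<D K
  β-mono-≤ J≤K with ℕ.m≤n⇒m<n∨m≡n J≤K
  ... | inj₁ J<K    = inj₁ (β-mono-< J<K)
  ... | inj₂ ≡.refl = ≤-refl

  -- With c = D^(1/2q), the factor c^(-q) is at least c^(-2q) = 1/D.
  q/D≤β[2q] : ∀ q .{{_ : NonZero q}} .{{_ : NonZero (q ℕ.+ q)}} →
              fromℕ q * D ⁻¹ ≤ β D 1<D (q ℕ.+ q)
  q/D≤β[2q] q@(suc _) = begin
    fromℕ q * D ⁻¹ ≤⟨ *-monoʳ-≤ (fromℕ-nonNeg q) (*-cancelʳ-≤ (^-pos q (c-pos K)) (begin
      D ⁻¹ * c K ^ q         ≤⟨ *-monoʳ-≤ (inj₁ (⁻¹-pos 0<D)) (begin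
        c K ^ q ≤⟨ ^-monoʳ-≤ (1<c K) (ℕ.m≤m+n q q) ⟩
        c K ^ K ≤⟨ c^K≤D K ⟩
        D       ∎) ⟩
      D ⁻¹ * D               ≈⟨ *-inverseˡ 0<D ⟩
      1#                     ≈⟨ ⁻¹-^-inverse q (c-pos K) ⟨
      (c K ⁻¹) ^ q * c K ^ q ∎)) ⟩
    βterm q K      ≤⟨ βterm≤β q K (ℕ.m<m+n q (s≤s z≤n)) ⟩
    β D 1<D K      ∎
    where K = q ℕ.+ q

  -- Costs with a free weight `g` on the root: `γ m` gives `Ψ`, and 1 gives the upper comparison
  -- function.

  cost : Carrier → Carrier → PosFun
  cost g lam K = 1# + g * c K + lam * β D 1<D K

  -- The nonnegative part `1 + g c` is dropped, and `β` is at least `q / D` from `K = 2q` on. The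
  -- Archimedean property supplies a `q` for which `lam * q / D` exceeds `b`.
  cost-coercive : ∀ {g lam} → 0# ≤ g → 0# < lam → IsCoercive (cost g lam)
  cost-coercive {g} {lam} 0≤g 0<lam b with archimedean-* b (*-pos 0<lam (⁻¹-pos 0<D))
  ... | n , b<n*lam/D = q ℕ.+ q , λ K 2q≤K → begin-strict
    b                      <⟨ b<n*lam/D ⟩
    fromℕ n * (lam * D ⁻¹) <⟨ *-monoˡ-< (*-pos 0<lam (⁻¹-pos 0<D)) (n<fromℕ[1+n] n) ⟩
    fromℕ q * (lam * D ⁻¹) ≈⟨ x*[y*z]≈y*[x*z] _ _ _ ⟩
    lam * (fromℕ q * D ⁻¹) ≤⟨ *-monoʳ-≤ (inj₁ 0<lam) (begin
      fromℕ q * D ⁻¹    ≤⟨ q/D≤β[2q] q ⟩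
      β D 1<D (q ℕ.+ q) ≤⟨ β-mono-≤ 2q≤K ⟩
      β D 1<D K         ∎) ⟩
    lam * β D 1<D K        ≈⟨ +-identityˡ _ ⟨
    0# + lam * β D 1<D K   ≤⟨ +-mono-≤ (0≤1+gc K) ≤-refl ⟩
    cost g lam K           ∎
    where
    q = suc n
    0≤1+gc : ∀ K .{{_ : NonZero K}} → 0# ≤ 1# + g * c K
    0≤1+gc K = begin
      0#            ≈⟨ +-identityʳ 0# ⟨
      0# + 0#       ≈⟨ +-congˡ (zeroˡ (c K)) ⟨
      0# + 0# * c K ≤⟨ +-mono-≤ 0≤1 (*-monoˡ-≤ (inj₁ (c-pos K)) 0≤g) ⟩
      1# + g * c K  ∎

  cost-monoˡ-< : ∀ {g₁ g₂} lam K .{{_ : NonZero K}} → g₁ < g₂ →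
                 cost g₁ lam K < cost g₂ lam K
  cost-monoˡ-< lam K g₁<g₂ =
    +-monoˡ-< _ (+-monoʳ-< 1# (*-monoˡ-< (c-pos K) g₁<g₂))

  -- The exchange uses `X = β`, which increases with `K`; hence a larger price cannot move the
  -- minimizer up.
  cost-minimizer-antitone : ∀ {g lam₁ lam₂} → lam₁ < lam₂ →
    ∀ {K₁ K₂} .{{_ : NonZero K₁}} .{{_ : NonZero K₂}} →
    IsMinimizer (cost g lam₁) K₁ → IsMinimizer (cost g lam₂) K₂ → K₂ ℕ.≤ K₁
  cost-minimizer-antitone {g} lam₁<lam₂ min₁ min₂ = ℕ.≮⇒≥ λ K₁<K₂ →
    minimizer-exchange (β D 1<D) (λ K → 1# + g * c K) lam₁<lam₂
      (IsMinimizer-resp-≈ (λ _ → +-comm _ _) min₁)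
      (IsMinimizer-resp-≈ (λ _ → +-comm _ _) min₂)
      (β-mono-< K₁<K₂)

  -- Here the exchange uses `X = c`, which decreases with `K`, so the direction is reversed.
  cost-minimizer-monotone : ∀ {g₁ g₂ lam} → g₁ < g₂ →
    ∀ {K₁ K₂} .{{_ : NonZero K₁}} .{{_ : NonZero K₂}} →
    IsMinimizer (cost g₁ lam) K₁ → IsMinimizer (cost g₂ lam) K₂ → K₁ ℕ.≤ K₂
  cost-minimizer-monotone {lam = lam} g₁<g₂ min₁ min₂ = ℕ.≮⇒≥ λ K₂<K₁ →
    minimizer-exchange c (λ K → 1# + lam * β D 1<D K) g₁<g₂
      (IsMinimizer-resp-≈ (λ _ → [x+y]+z≈y+[x+z] _ _ _) min₁)
      (IsMinimizer-resp-≈ (λ _ → [x+y]+z≈y+[x+z] _ _ _) min₂)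
      (c-anti-mono-< K₂<K₁)

-- The weights `γ m` and their link to `α`.

module Weights (ℝ : CompleteOrderedField) where
  open CompleteOrderedField ℝ
  open Optimum ℝ
  open Objective ℝ using (α; Ψ; β)
  open OrderedField ℝ
  open Minimization ℝ
  open ≤-Reasoning

  -- This is `(m - 1)/(m + 1)`, written so that strict increase and the bound by 1 follow from the
  -- reciprocal alone.
  γ : ℕ → Carrier
  γ m = 1# - fromℕ 2 / fromℕ (suc m)

  α≈1+γ* : ∀ m x → α m x ≈ 1# + γ m * x
  α≈1+γ* m x = begin-equality
    1# + x - fromℕ 2 * x * h        ≈⟨ +-assoc 1# x _ ⟩
    1# + (x - fromℕ 2 * x * h)      ≈⟨ +-congˡ (+-cong (*-identityˡ x) (begin-equality
      - (fromℕ 2 * h) * x ≈⟨ -‿distribˡ-* _ x ⟨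
      - (fromℕ 2 * h * x) ≈⟨ -‿cong (xy∙z≈xz∙y _ _ _) ⟩
      - (fromℕ 2 * x * h) ∎)) ⟨
    1# + (1# * x + - (fromℕ 2 * h) * x) ≈⟨ +-congˡ (distribʳ x 1# _) ⟨
    1# + γ m * x                        ∎
    where
    h = fromℕ (suc m) ⁻¹
    open CommutativeSemigroupProperties *-commutativeSemigroup using (xy∙z≈xz∙y)

  γ-mono-< : ∀ {m n} → m ℕ.< n → γ m < γ n
  γ-mono-< {m} m<n = +-monoʳ-< 1# (-‿anti-mono-< (*-monoʳ-< (fromℕ-pos 2)
    (⁻¹-anti-mono-< (fromℕ-pos (suc m)) (fromℕ-mono-< (s≤s m<n)))))

  γ[1]≈0 : γ 1 ≈ 0#
  γ[1]≈0 = begin-equality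
    1# - fromℕ 2 / fromℕ 2 ≈⟨ +-congˡ (-‿cong (*-inverseʳ (fromℕ-pos 2))) ⟩
    1# - 1#                ≈⟨ -‿inverseʳ 1# ⟩
    0#                     ∎

  γ-pos : ∀ {m} → 2 ℕ.≤ m → 0# < γ m
  γ-pos 2≤m = <-respˡ-≈ γ[1]≈0 (γ-mono-< 2≤m)

  γ<1 : ∀ m → γ m < 1#
  γ<1 m = x-y<x 1# (*-pos (fromℕ-pos 2) (⁻¹-pos (fromℕ-pos (suc m))))

  1+γ≈2m/[1+m] : ∀ m → 1# + γ m ≈ fromℕ (2 ℕ.* m) / fromℕ (suc m)
  1+γ≈2m/[1+m] m = begin-equality
    1# + (1# - fromℕ 2 * h)           ≈⟨ +-assoc 1# 1# _ ⟨
    1# + 1# - fromℕ 2 * h             ≈⟨ +-congʳ 2≈ ⟩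
    fromℕ 2 * h + fromℕ 2 * fromℕ m * h - fromℕ 2 * h ≈⟨ xyx⁻¹≈y _ _ ⟩
    fromℕ 2 * fromℕ m * h             ≈⟨ *-congʳ (×1-homo-* 2 m) ⟨
    fromℕ (2 ℕ.* m) * h               ∎
    where
    h = fromℕ (suc m) ⁻¹
    open Solver commutativeSemiring using (solve; _:=_; _:+_; _:*_; con)
    -- Expanding 2 as `2 (1 + m) h` produces the summand `2 h` that the subtraction cancels; the
    -- semiring solver then never meets a negative.
    2≈ : 1# + 1# ≈ fromℕ 2 * h + fromℕ 2 * fromℕ m * h
    2≈ = begin-equality
      1# + 1#                    ≈⟨ +-congˡ (+-identityʳ 1#) ⟨
      fromℕ 2                    ≈⟨ *-identityʳ _ ⟨
      fromℕ 2 * 1#               ≈⟨ *-congˡ (*-inverseʳ (fromℕ-pos (suc m))) ⟨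
      fromℕ 2 * ((1# + fromℕ m) * h)
        ≈⟨ solve 3 (λ t n h → t :* ((con 1 :+ n) :* h) := t :* h :+ t :* n :* h)
                   refl (fromℕ 2) (fromℕ m) h ⟩
      fromℕ 2 * h + fromℕ 2 * fromℕ m * h ∎

  -- The objective as a cost, and the cases `m = 1` and `λ = 0`.

  module _ (D : Carrier) (1<D : 1# < D) where
    open Roots ℝ D 1<D

    Ψ≈cost : ∀ m lam K .{{_ : NonZero K}} → Ψ m D 1<D lam K ≈ cost (γ m) lam K
    Ψ≈cost m lam K = +-congʳ (α≈1+γ* m (c K))

    Ψ-monoˡ-< : ∀ {m n} lam → m ℕ.< n → ∀ K .{{_ : NonZero K}} →
                Ψ m D 1<D lam K < Ψ n D 1<D lam K
    Ψ-monoˡ-< {m} {n} lam m<n K = begin-strict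
      Ψ m D 1<D lam K  ≈⟨ Ψ≈cost m lam K ⟩
      cost (γ m) lam K <⟨ cost-monoˡ-< lam K (γ-mono-< m<n) ⟩
      cost (γ n) lam K ≈⟨ Ψ≈cost n lam K ⟨
      Ψ n D 1<D lam K  ∎

    cost-one : ∀ lam K .{{_ : NonZero K}} → cost 1# lam K ≈ 1# + c K + lam * β D 1<D K
    cost-one lam K = +-congʳ (+-congˡ (*-identityˡ (c K)))

    Ψ<1+c+λβ : ∀ m lam K .{{_ : NonZero K}} → Ψ m D 1<D lam K < 1# + c K + lam * β D 1<D K
    Ψ<1+c+λβ m lam K = begin-strict
      Ψ m D 1<D lam K              ≈⟨ Ψ≈cost m lam K ⟩
      cost (γ m) lam K             <⟨ cost-monoˡ-< lam K (γ<1 m) ⟩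
      cost 1# lam K                ≈⟨ cost-one lam K ⟩
      1# + c K + lam * β D 1<D K   ∎

    -- The weight of the root vanishes at `m = 1`, which leaves only the increasing interruption
    -- term and forces the minimizer 1.
    Ψ₁≈1+λβ : ∀ lam K .{{_ : NonZero K}} → Ψ 1 D 1<D lam K ≈ 1# + lam * β D 1<D K
    Ψ₁≈1+λβ lam K = begin-equality
      Ψ 1 D 1<D lam K                   ≈⟨ Ψ≈cost 1 lam K ⟩
      1# + γ 1 * c K + lam * β D 1<D K  ≈⟨ +-congʳ (+-congˡ (*-congʳ γ[1]≈0)) ⟩
      1# + 0# * c K + lam * β D 1<D K   ≈⟨ +-congʳ (+-congˡ (zeroˡ (c K))) ⟩
      1# + 0# + lam * β D 1<D K         ≈⟨ +-congʳ (+-identityʳ 1#) ⟩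
      1# + lam * β D 1<D K              ∎

    Ψ₁-mono-< : ∀ {lam} → 0# < lam → ∀ {J K} .{{_ : NonZero J}} .{{_ : NonZero K}} →
                J ℕ.< K → Ψ 1 D 1<D lam J < Ψ 1 D 1<D lam K
    Ψ₁-mono-< {lam} 0<lam {J} {K} J<K = begin-strict
      Ψ 1 D 1<D lam J      ≈⟨ Ψ₁≈1+λβ lam J ⟩
      1# + lam * β D 1<D J <⟨ +-monoʳ-< 1# (*-monoʳ-< 0<lam (β-mono-< J<K)) ⟩
      1# + lam * β D 1<D K ≈⟨ Ψ₁≈1+λβ lam K ⟨
      Ψ 1 D 1<D lam K      ∎

    Ψ₁-minimizer : ∀ {lam} → 0# < lam → IsMinimizer (Ψ 1 D 1<D lam) 1
    Ψ₁-minimizer 0<lam (suc zero)    = ≤-refl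
    Ψ₁-minimizer 0<lam (suc (suc n)) = inj₁ (Ψ₁-mono-< 0<lam (s≤s (s≤s z≤n)))

    Ψ₁-minimizer-unique : ∀ {lam} → 0# < lam → ∀ K .{{_ : NonZero K}} →
                          IsMinimizer (Ψ 1 D 1<D lam) K → K ≡ 1
    Ψ₁-minimizer-unique 0<lam (suc zero)    _       = ≡.refl
    Ψ₁-minimizer-unique 0<lam (suc (suc n)) minimal =
      contradiction (Ψ₁-mono-< 0<lam (s≤s (s≤s z≤n))) (≤⇒≯ (minimal 1))

    Ψ-λ≈0 : ∀ m K .{{_ : NonZero K}} → Ψ m D 1<D 0# K ≈ 1# + γ m * c K
    Ψ-λ≈0 m K = begin-equality
      Ψ m D 1<D 0# K                   ≈⟨ Ψ≈cost m 0# K ⟩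
      1# + γ m * c K + 0# * β D 1<D K  ≈⟨ +-congˡ (zeroˡ _) ⟩
      1# + γ m * c K + 0#              ≈⟨ +-identityʳ _ ⟩
      1# + γ m * c K                   ∎

    -- Strict since `γ m > 0` and every root exceeds 1. It yields both the lower bound of the
    -- infimum and the failure of attainment.
    2m/[1+m]<Ψ : ∀ {m} → 2 ℕ.≤ m → ∀ K .{{_ : NonZero K}} →
                 fromℕ (2 ℕ.* m) / fromℕ (suc m) < Ψ m D 1<D 0# K
    2m/[1+m]<Ψ {m} 2≤m K = begin-strict
      fromℕ (2 ℕ.* m) / fromℕ (suc m) ≈⟨ 1+γ≈2m/[1+m] m ⟨
      1# + γ m                        ≈⟨ +-congˡ (*-identityʳ _) ⟨
      1# + γ m * 1#                   <⟨ +-monoʳ-< 1# (*-monoʳ-< (γ-pos 2≤m) (1<c K)) ⟩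
      1# + γ m * c K                  ≈⟨ Ψ-λ≈0 m K ⟨
      Ψ m D 1<D 0# K                  ∎

    Ψ-λ≈0-infimum : ∀ {m} → 2 ℕ.≤ m →
      IsInfimum (Ψ m D 1<D 0#) (fromℕ (2 ℕ.* m) / fromℕ (suc m))
    Ψ-λ≈0-infimum {m} 2≤m = (λ K → inj₁ (2m/[1+m]<Ψ 2≤m K)) , approx
      where
      0<γ = γ-pos 2≤m
      approx : ∀ y → fromℕ (2 ℕ.* m) / fromℕ (suc m) < y →
               Σ[ K ∈ ℕ ] Σ[ K≥1 ∈ NonZero K ] Ψ m D 1<D 0# K {{K≥1}} < y
      approx y v<y = suc n , _ , Ψ<y
        where
        d = y - (1# + γ m)
        -- Chosen so that `1 + γ m (1 + ε)` equals `y` exactly.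
        ε = γ m ⁻¹ * d
        0<ε : 0# < ε
        0<ε = *-pos (⁻¹-pos 0<γ) (x<y⇒0<y-x (<-respˡ-≈ (sym (1+γ≈2m/[1+m] m)) v<y))
        n = proj₁ (c→1 0<ε)
        Ψ<y : Ψ m D 1<D 0# (suc n) < y
        Ψ<y = begin-strict
          Ψ m D 1<D 0# (suc n)      ≈⟨ Ψ-λ≈0 m (suc n) ⟩
          1# + γ m * c (suc n)      <⟨ +-monoʳ-< 1# (*-monoʳ-< 0<γ (proj₂ (c→1 0<ε))) ⟩
          1# + γ m * (1# + ε)       ≈⟨ +-congˡ (distribˡ (γ m) 1# ε) ⟩
          1# + (γ m * 1# + γ m * ε) ≈⟨ +-congˡ (+-cong (*-identityʳ _) (x*[x⁻¹*y]≈y _ 0<γ)) ⟩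
          1# + (γ m + d)            ≈⟨ +-assoc 1# _ _ ⟨
          1# + γ m + d              ≈⟨ x+[y-x]≈y _ y ⟩
          y                         ∎

-- Exactness of the one-round fallback for equal sizes.

module OneRound (ℝ : CompleteOrderedField) where
  open CompleteOrderedField ℝ
  open Fallback ℝ
  open OrderedField ℝ
  open ≤-Reasoning
  open Sort decTotalOrder using (sort; sort-↗; sortingAlgorithm)
  open SortBase.SortingAlgorithm sortingAlgorithm using (sort-↭ₛ)
  open Sorted totalOrder using (Sorted)
  open Solver commutativeSemiring using (solve; _:=_; _:+_; _:*_; con)

  -- The clock `now` is general because it advances in the recursion. Each job bears the initial
  -- delay `now - τ`, and each size is paid by its job and all jobs after it, which is the weight in
  -- `weightedSum`.
  serveRound-completes : ∀ {cap} τ now {rs} → All (_≤ cap) rs →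
    let o = serveRound cap now rs in
    Outcome.unfinished o ≡ [] × Pres o ≡ 0 ×
    Fres τ o ≈ fromℕ (length rs) * (now - τ) + weightedSum rs
  serveRound-completes τ now [] =
    ≡.refl , ≡.refl , sym (trans (+-identityʳ _) (zeroˡ _))
  serveRound-completes {cap} τ now {r ∷ rs} (r≤cap ∷ rs≤cap)
    with r ≤? cap | serveRound-completes τ (now + r) rs≤cap
  ... | no r≰cap | _ = contradiction r≤cap r≰cap
  ... | yes _    | unfinished≡[] , Pres≡0 , Fres≈ = unfinished≡[] , Pres≡0 , (begin-equality
    now + r - τ + Fres τ (serveRound cap (now + r) rs)
      ≈⟨ +-congˡ Fres≈ ⟩
    now + r - τ + (L * (now + r - τ) + W)
      ≈⟨ +-cong now+r-τ≈ (+-congʳ (*-congˡ now+r-τ≈)) ⟩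
    t + r + (L * (t + r) + W)
      ≈⟨ solve 4 (λ t r L W → t :+ r :+ (L :* (t :+ r) :+ W) :=
                  (con 1 :+ L) :* t :+ ((con 1 :+ L) :* r :+ W)) refl t r L W ⟩
    (1# + L) * t + ((1# + L) * r + W) ∎)
    where
    L = fromℕ (length rs)
    W = weightedSum rs
    t = now - τ
    open CommutativeSemigroupProperties +-commutativeSemigroup using (xy∙z≈xz∙y)
    now+r-τ≈ : now + r - τ ≈ t + r
    now+r-τ≈ = xy∙z≈xz∙y now r (- τ)

  weightedSum-cong : ∀ {xs ys} → Pointwise _≈_ xs ys → weightedSum xs ≈ weightedSum ys
  weightedSum-cong []            = refl
  weightedSum-cong (x≈y ∷ xs≋ys) = +-cong
    (*-cong (reflexive (≡.cong fromℕ (Pointwise-length (x≈y ∷ xs≋ys)))) x≈y)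
    (weightedSum-cong xs≋ys)

  -- Two ascending arrangements of the same list agree pointwise up to `≈`, so sorting a sorted list
  -- preserves the weighted sum.
  OPT-sorted : ∀ {rs} → Sorted rs → OPT rs ≈ weightedSum rs
  OPT-sorted {rs} rs↗ = weightedSum-cong (↗↭↗⇒≋ totalOrder (sort-↗ rs) rs↗ (sort-↭ₛ rs))

  -- Starting at `τ` makes the initial delay zero, and no job is interrupted, so the price is
  -- multiplied by 0.
  serveRound-optimal : ∀ {cap} τ {rs} → All (_≤ cap) rs → Sorted rs →
    let o = serveRound cap τ rs in
    Outcome.unfinished o ≡ [] × (∀ κ → Fres τ o + κ * fromℕ (Pres o) ≈ OPT rs)
  serveRound-optimal {cap} τ {rs} rs≤cap rs↗ with serveRound-completes τ τ rs≤cap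
  ... | unfinished≡[] , Pres≡0 , Fres≈ = unfinished≡[] , λ κ → begin-equality
    Fres τ o + κ * fromℕ (Pres o) ≈⟨ +-cong Fres≈ (*-congˡ (reflexive (≡.cong fromℕ Pres≡0))) ⟩
    n * (τ - τ) + weightedSum rs + κ * 0# ≈⟨ +-cong (+-congʳ (*-congˡ (-‿inverseʳ τ))) (zeroʳ κ) ⟩
    n * 0# + weightedSum rs + 0#  ≈⟨ +-identityʳ _ ⟩
    n * 0# + weightedSum rs       ≈⟨ +-congʳ (zeroʳ n) ⟩
    0# + weightedSum rs           ≈⟨ +-identityˡ _ ⟩
    weightedSum rs                ≈⟨ OPT-sorted rs↗ ⟨
    OPT rs                        ∎
    where
    o = serveRound cap τ rs
    n = fromℕ (length rs)

  -- Only `r ≤ s` is asked of the head, so that each entry equal to `s` can take its place in the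
  -- recursion.
  ≤-constant-sorted : ∀ {s r rs} → r ≤ s → All (_≈ s) rs → Sorted (r ∷ rs)
  ≤-constant-sorted r≤s [] = [-]
  ≤-constant-sorted {s} {r} {x ∷ _} r≤s (x≈s ∷ rs≈s) =
    (begin
      r ≤⟨ r≤s ⟩
      s ≈⟨ x≈s ⟨
      x ∎) ∷ ≤-constant-sorted (inj₂ x≈s) rs≈s

  equal-sizes-optimal : ∀ {s r rs} τ → r ≤ s → All (_≈ s) rs →
    let o = serveRound s τ (r ∷ rs) in
    Outcome.unfinished o ≡ [] × (∀ κ → Fres τ o + κ * fromℕ (Pres o) ≈ OPT (r ∷ rs))
  equal-sizes-optimal τ r≤s rs≈s = serveRound-optimal τ
    (r≤s ∷ All.map inj₂ rs≈s) (≤-constant-sorted r≤s rs≈s)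

theorem6p1 :
    (ℝ : CompleteOrderedField) →
    let open CompleteOrderedField ℝ
        open Optimum ℝ
        open Objective ℝ
        open Fallback ℝ
    in
    -- (i)
    (∀ D (1<D : 1# < D) m lam → 2 ℕ.≤ m → 0# < lam →
      Σ[ K ∈ ℕ ] Σ[ K≥1 ∈ NonZero K ] IsMinimizer (Ψ m D 1<D lam) K {{K≥1}})
    ×
    -- (ii)
    (∀ D (1<D : 1# < D) m lam₁ lam₂ → 2 ℕ.≤ m → 0# < lam₁ → lam₁ < lam₂ →
      ∀ K₁ K₂ .{{_ : NonZero K₁}} .{{_ : NonZero K₂}} →
      IsMinimizer (Ψ m D 1<D lam₁) K₁ →
      IsMinimizer (Ψ m D 1<D lam₂) K₂ →
      K₂ ℕ.≤ K₁)
    ×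
    -- (iii)
    (∀ D (1<D : 1# < D) lam m₁ m₂ → 0# < lam → 2 ℕ.≤ m₁ → m₁ ℕ.< m₂ →
      ∀ K₁ K₂ .{{_ : NonZero K₁}} .{{_ : NonZero K₂}} →
      IsMinimizer (Ψ m₁ D 1<D lam) K₁ →
      IsMinimizer (Ψ m₂ D 1<D lam) K₂ →
      K₁ ℕ.≤ K₂)
    ×
    -- (iv)
    (∀ D (1<D : 1# < D) lam → 0# < lam →
      (∀ m₁ m₂ → 2 ℕ.≤ m₁ → m₁ ℕ.< m₂ → ∀ Ψ*₁ Ψ*₂ →
        IsMinimum (Ψ m₁ D 1<D lam) Ψ*₁ →
        IsMinimum (Ψ m₂ D 1<D lam) Ψ*₂ →
        Ψ*₁ < Ψ*₂)
      ×
      (∃[ w ] IsMinimum (λ K → 1# + root D 1<D K + lam * β D 1<D K) w ×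
        (∀ m Ψ* → 2 ℕ.≤ m → IsMinimum (Ψ m D 1<D lam) Ψ* → Ψ* < w)))
    ×
    -- (v), D > 1 and m = 1
    (∀ D (1<D : 1# < D) lam → 0# < lam →
      IsMinimizer (Ψ 1 D 1<D lam) 1 ×
      (∀ K .{{_ : NonZero K}} → IsMinimizer (Ψ 1 D 1<D lam) K → K ≡ 1))
    ×
    -- (v), D = 1
    (∀ n (ℓ u p : Fin n → Carrier) (s₀ κ : Carrier) →
      0# < s₀ → 0# ≤ κ →
      (∀ j → p j ≈ s₀) → (∀ j → 0# < ℓ j) → (∀ j → ℓ j ≤ u j) →
      ∀ (order : List (Fin n)) → order ↭ allFin n →
      Linked (λ i j → u i ≤ u j) order →
      ∀ τ e rest → runToTrigger u p 0# order ≡ just (τ , e , rest) →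
      let r = p e - u e ∷ map p rest
          o = serveRound s₀ τ r
      in Outcome.unfinished o ≡ [] ×
         Fres τ o + κ * fromℕ (Pres o) ≈ OPT r)
    ×
    -- (vi)
    (∀ D (1<D : 1# < D) m → 2 ℕ.≤ m →
      IsInfimum (Ψ m D 1<D 0#) (fromℕ (2 ℕ.* m) / fromℕ (suc m)) ×
      (∀ K .{{_ : NonZero K}} →
        ¬ (Ψ m D 1<D 0# K ≈ fromℕ (2 ℕ.* m) / fromℕ (suc m))))
theorem6p1 ℝ =
  (λ D 1<D m lam 2≤m 0<lam →
    let open Roots ℝ D 1<D
        K , K≥1 , minimal = coercive⇒minimizer (cost-coercive (inj₁ (γ-pos 2≤m)) 0<lam)
    in K , K≥1 , IsMinimizer-resp-≈ (λ J → sym (Ψ≈cost D 1<D m lam J)) {{K≥1}} minimal) ,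
  (λ D 1<D m lam₁ lam₂ _ _ lam₁<lam₂ K₁ K₂ min₁ min₂ →
    Roots.cost-minimizer-antitone ℝ D 1<D lam₁<lam₂
      (IsMinimizer-resp-≈ (Ψ≈cost D 1<D m lam₁) min₁)
      (IsMinimizer-resp-≈ (Ψ≈cost D 1<D m lam₂) min₂)) ,
  (λ D 1<D lam m₁ m₂ _ _ m₁<m₂ K₁ K₂ min₁ min₂ →
    Roots.cost-minimizer-monotone ℝ D 1<D (γ-mono-< m₁<m₂)
      (IsMinimizer-resp-≈ (Ψ≈cost D 1<D m₁ lam) min₁)
      (IsMinimizer-resp-≈ (Ψ≈cost D 1<D m₂ lam) min₂)) ,
  (λ D 1<D lam 0<lam →
    (λ m₁ m₂ _ m₁<m₂ _ _ → IsMinimum-mono-< (Ψ-monoˡ-< D 1<D lam m₁<m₂)) ,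
    let open Roots ℝ D 1<D
        K , K≥1 , minimal = coercive⇒minimizer (cost-coercive 0≤1 0<lam)
        -- The upper comparison function is the cost of weight 1, so it too attains its minimum.
        w-minimum = K , K≥1 , IsMinimizer-resp-≈ (cost-one D 1<D lam) {{K≥1}} minimal , refl
    in _ , w-minimum , λ m _ _ Ψ*-minimum →
         IsMinimum-mono-< (Ψ<1+c+λβ D 1<D m lam) Ψ*-minimum w-minimum) ,
  (λ D 1<D lam 0<lam →
    Ψ₁-minimizer D 1<D 0<lam , Ψ₁-minimizer-unique D 1<D 0<lam) ,
  (λ n ℓ u p s₀ κ _ _ p≈s₀ 0<ℓ ℓ≤u order _ _ τ e rest _ →
    let unfinished≡[] , cost≈OPT = equal-sizes-optimal τ
          -- The triggering job has received `u e ≥ ℓ e > 0`, so less than `s₀` of it remains.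
          (inj₁ (<-respʳ-≈ (p≈s₀ e) (x-y<x (p e) (<-≤-trans (0<ℓ e) (ℓ≤u e)))))
          (All.map⁺ (All.universal p≈s₀ rest))
    in unfinished≡[] , cost≈OPT κ) ,
  (λ D 1<D m 2≤m →
    Ψ-λ≈0-infimum D 1<D 2≤m ,
    λ K Ψ≈v → irrefl (sym Ψ≈v) (2m/[1+m]<Ψ D 1<D 2≤m K))
  where
  open CompleteOrderedField ℝ
  open OrderedField ℝ
  open Minimization ℝ
  open Weights ℝ
  open OneRound ℝ
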